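{- Let $G=(V,E)$ be a finite simple connected graph. Then $\beth^{1}(K^{\chi(G)})\le \beth^{1}(G)$; that is, $$\binom{\chi(G)}{2}-\binom{\chi(G)}{1}\le |E|-|V|.$$
   Context: All graphs are finite and simple. $K^{t}$ is the complete graph on $t$ vertices and $\chi(G)$ is the chromatic number of $G$. For a connected graph $G$, the first graph characteristic is $\beth^{1}(G)=|E(G)|-|V(G)|$. -}

module Defs where

open import Data.Fin using (Fin; funToFin; finToFun)
open import Data.Fin.Properties using (_≟_; _<?_; any?; all?; finToFun-funToFin)
open import Data.Integer as ℤ using (ℤ; +_)
open import Data.List using (List; allFin; cartesianProduct; filter; length)
open import Data.Nat using (ℕ; zero; suc; _≤_; z≤n; s≤s)
open import Data.Product using (_×_; _,_; ∃; ∃-syntax; proj₁; proj₂)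
open import Function using (id; _∘_)
open import Level using (0ℓ)
open import Relation.Binary using (Rel; Decidable; Symmetric; Irreflexive)
open import Relation.Binary.Construct.Closure.ReflexiveTransitive using (Star)
open import Relation.Binary.PropositionalEquality using (_≡_; _≢_; sym; trans)
open import Relation.Nullary using (yes; no; contradiction)
open import Relation.Nullary.Decidable using (map′; ¬?; _→-dec_; _×-dec_)
import Relation.Unary as U

-- Up to isomorphism, a finite simple graph on n vertices has vertex set Fin n.
record Graph (n : ℕ) : Set₁ where
  infix 4 _~_ _~?_
  field
    _~_      : Rel (Fin n) 0ℓ
    _~?_     : Decidable _~_
    ~-sym    : Symmetric _~_
    ~-irrefl : Irreflexive _≡_ _~_

module _ {n : ℕ} (G : Graph n) where
  open Graph G

  ∣V∣ : ℕ
  ∣V∣ = n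

  -- The edge {u , v} is listed once, as the pair with u < v.
  edges : List (Fin n × Fin n)
  edges = filter (λ (u , v) → (u <? v) ×-dec (u ~? v))
                 (cartesianProduct (allFin n) (allFin n))

  ∣E∣ : ℕ
  ∣E∣ = length edges

  -- The graph without vertices does not count as connected.
  Connected : Set
  Connected = Fin n × (∀ u v → Star _~_ u v)

  ℶ¹ : ℤ
  ℶ¹ = + ∣E∣ ℤ.- + ∣V∣

  Proper : ∀ {k} → (Fin n → Fin k) → Set
  Proper c = ∀ u v → u ~ v → c u ≢ c v

  Colourable : ℕ → Set
  Colourable k = ∃[ c ] Proper {k} c

  proper? : ∀ {k} → U.Decidable (Proper {k})
  proper? c = all? λ u → all? λ v → (u ~? v) →-dec ¬? (c u ≟ c v)

  -- Searches all k ^ n maps Fin n → Fin k through their codes in Fin (k ^ n).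
  colourable? : U.Decidable Colourable
  colourable? k = map′ decode encode (any? {P = Proper ∘ finToFun} (proper? ∘ finToFun))
    where
    decode : (∃[ x ] Proper (finToFun x)) → Colourable k
    decode (x , p) = finToFun x , p

    encode : Colourable k → ∃[ x ] Proper (finToFun x)
    encode (c , p) = funToFin c , λ u v u~v eq → p u v u~v
      (trans (sym (finToFun-funToFin c u)) (trans eq (finToFun-funToFin c v)))

  colourable-∣V∣ : Colourable n
  colourable-∣V∣ = id , λ u v u~v u≡v → ~-irrefl u≡v u~v

IsLeast : (ℕ → Set) → ℕ → Set
IsLeast P m = P m × (∀ k → P k → m ≤ k)

least : ∀ {P : ℕ → Set} → U.Decidable P → ∀ n → P n → ∃ (IsLeast P)
least P? zero    p = zero , p , λ _ _ → z≤n
least {P} P? (suc n) p with P? zero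
... | yes p₀ = zero , p₀ , λ _ _ → z≤n
... | no ¬p₀ with least {P ∘ suc} (P? ∘ suc) n p
...   | m , pm , min = suc m , pm , λ where
  zero    p₀ → contradiction p₀ ¬p₀
  (suc k) pk → s≤s (min k pk)

χ-least : ∀ {n} (G : Graph n) → ∃ (IsLeast (Colourable G))
χ-least {n} G = least (colourable? G) n (colourable-∣V∣ G)

χ : ∀ {n} → Graph n → ℕ
χ G = proj₁ (χ-least G)

χ-isLeast : ∀ {n} (G : Graph n) → IsLeast (Colourable G) (χ G)
χ-isLeast G = proj₂ (χ-least G)

K : (t : ℕ) → Graph t
K t = record
  { _~_      = _≢_
  ; _~?_     = λ u v → ¬? (u ≟ v)
  ; ~-sym    = λ u≢v v≡u → u≢v (sym v≡u)
  ; ~-irrefl = λ u≡v u≢v → u≢v u≡v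
  }

{-# OPTIONS --safe #-}
-- Add the vertices one at a time so that each new vertex v is adjacent to an
-- earlier one, keeping the invariant C(k,2) + |S| ≤ e(S) + k for a proper
-- colouring of the current set S with k colours. If some colour is missing
-- among the d ≥ 1 earlier neighbours of v, it is given to v, and |S| grows by
-- 1 and e(S) by d. Otherwise d ≥ k, v gets a new colour, and C(k,2) grows by
-- k. At the end χ ≤ k, and C(k,2) - k is monotone for k ≥ 1.
module Submission where

open import Data.Fin using (Fin; zero; suc; _<_)
open import Data.Fin.Properties as Fin using (_<?_; any?; suc-injective)
open import Data.Integer using (+_; _-_; _≤_; _⊖_)
import Data.Integer.Properties as ℤ
open import Data.List using (List; []; _∷_; [_]; _++_; length; map; filter; allFin; cartesianProduct)
open import Data.List.Properties using (length-++; length-++-sucʳ; length-map; length-tabulate; length-filter)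
open import Data.List.Membership.Propositional using (_∈_; _∉_)
open import Data.List.Membership.Propositional.Properties
open import Data.List.Relation.Binary.Subset.Propositional using (_⊆_)
open import Data.List.Relation.Unary.All using ([]; lookup)
open import Data.List.Relation.Unary.All.Properties using (¬Any⇒All¬)
open import Data.List.Relation.Unary.AllPairs using ([]; _∷_)
open import Data.List.Relation.Unary.Any using (here; there)
open import Data.List.Relation.Unary.Unique.Propositional using (Unique)
import Data.List.Relation.Unary.Unique.Propositional.Properties as Unique
open import Data.Nat as ℕ using (ℕ; zero; suc; z≤n; s≤s; _+_)
open import Data.Nat.Combinatorics using (_C_; nC1≡n; nCk+nC[k+1]≡[n+1]C[k+1])
import Data.Nat.Properties as ℕ
open import Data.Nat.Tactic.RingSolver using (solve-∀)
open import Data.Product using (_×_; _,_; ∃-syntax; proj₁; proj₂)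
open import Data.Product.Properties using (,-injectiveˡ; ,-injectiveʳ)
open import Data.Sum using (inj₁; inj₂)
open import Data.Vec.Functional using (updateAt)
open import Data.Vec.Functional.Properties using (updateAt-updates; updateAt-minimal)
open import Function using (id; const; _∘_; case_of_)
open import Relation.Binary.Construct.Closure.ReflexiveTransitive using (Star; ε; _◅_)
open import Relation.Binary.PropositionalEquality using (_≡_; _≢_; refl; sym; trans; cong; cong₂; subst; subst₂)
open import Relation.Nullary using (yes; no; ¬_; contradiction)
open import Relation.Nullary.Decidable using (¬?; _×-dec_; decidable-stable)
open import Defs

-- Counting in lists and arithmetic of binomial coefficients.

⊆-length : ∀ {A : Set} {xs ys : List A} → Unique xs → xs ⊆ ys → length xs ℕ.≤ length ys
⊆-length []           _     = z≤n
-- One occurrence of `x` is deleted from `ys`. As `x` does not recur in `xs`, the tail still lies in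
-- what remains.
⊆-length {xs = x ∷ xs} (x∉xs ∷ xs!) xs⊆ys with ∈-∃++ (xs⊆ys (here refl))
... | as , bs , refl = ℕ.≤-trans (s≤s (⊆-length xs! xs⊆as++bs)) (ℕ.≤-reflexive (sym (length-++-sucʳ as x bs)))
  where
  xs⊆as++bs : xs ⊆ as ++ bs
  xs⊆as++bs z∈xs with ∈-++⁻ as (xs⊆ys (there z∈xs))
  ... | inj₁ z∈as         = ∈-++⁺ˡ z∈as
  ... | inj₂ (here z≡x)   = contradiction (sym z≡x) (lookup x∉xs z∈xs)
  ... | inj₂ (there z∈bs) = ∈-++⁺ʳ as z∈bs

[1+k]C2≡k+kC2 : ∀ k → suc k C 2 ≡ k + k C 2
[1+k]C2≡k+kC2 k = trans (sym (nCk+nC[k+1]≡[n+1]C[k+1] k 1)) (cong (_+ k C 2) (nC1≡n k))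

-- C(k,2) - k is monotone only from k = 1 on: its values at 0 and 1 are 0 and -1.
C2-mono : ∀ {j k} → 1 ℕ.≤ j → j ℕ.≤′ k → j C 2 + k ℕ.≤ k C 2 + j
C2-mono _   ℕ.≤′-refl = ℕ.≤-refl
C2-mono {j} 1≤j (ℕ.≤′-step {k} j≤k) = begin
  j C 2 + suc k       ≡⟨ ℕ.+-suc (j C 2) k ⟩
  -- `C(k,2)` gains `k` in this step against a gain of 1 on the left; `1 ≤ j ≤ k` pays for it.
  1 + (j C 2 + k)     ≤⟨ ℕ.+-mono-≤ (ℕ.≤-trans 1≤j (ℕ.≤′⇒≤ j≤k)) (C2-mono 1≤j j≤k) ⟩
  k + (k C 2 + j)     ≡⟨ ℕ.+-assoc k (k C 2) j ⟨
  k + k C 2 + j       ≡⟨ cong (_+ j) ([1+k]C2≡k+kC2 k) ⟨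
  suc k C 2 + j       ∎
  where open ℕ.≤-Reasoning

-- Lets the argument run in ℕ with all terms moved to their positive side. Shifting the first
-- difference by `q` and the second by `n` gives both the subtrahend `n + q`.
m+q≤p+n⇒m-n≤p-q : ∀ m n p q → m + q ℕ.≤ p + n → + m - + n ≤ + p - + q
m+q≤p+n⇒m-n≤p-q m n p q m+q≤p+n = begin
  + m - + n           ≡⟨ ℤ.m-n≡m⊖n m n ⟩
  m ⊖ n               ≡⟨ ℤ.+-cancelˡ-⊖ q m n ⟨
  (q + m) ⊖ (q + n)   ≤⟨ ℤ.⊖-monoˡ-≤ (q + n) (subst₂ ℕ._≤_ (ℕ.+-comm m q) (ℕ.+-comm p n) m+q≤p+n) ⟩
  (n + p) ⊖ (q + n)   ≡⟨ cong ((n + p) ⊖_) (ℕ.+-comm q n) ⟩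
  (n + p) ⊖ (n + q)   ≡⟨ ℤ.+-cancelˡ-⊖ n p q ⟩
  p ⊖ q               ≡⟨ ℤ.m-n≡m⊖n p q ⟨
  + p - + q           ∎
  where open ℤ.≤-Reasoning

-- Edge lists, and the edges of a complete graph.

module _ {n : ℕ} (G : Graph n) where
  open Graph G

  edges-unique : Unique (edges G)
  edges-unique = Unique.filter⁺ _ (Unique.cartesianProduct⁺ (Unique.allFin⁺ n) (Unique.allFin⁺ n))

  ∈-edges⁺ : ∀ {u v} → u < v → u ~ v → (u , v) ∈ edges G
  ∈-edges⁺ u<v u~v = ∈-filter⁺ _ (∈-cartesianProduct⁺ (∈-allFin _) (∈-allFin _)) (u<v , u~v)

  ∈-edges⁻ : ∀ {u v} → (u , v) ∈ edges G → u < v × u ~ v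
  ∈-edges⁻ = proj₂ ∘ ∈-filter⁻ _ {xs = cartesianProduct (allFin n) (allFin n)}

-- An upper bound suffices, since this count stands on the smaller side of the theorem. The `t`
-- edges at vertex `zero` and a shifted copy of `K t` exhaust the edges, as in Pascal's rule.
∣E∣-K : ∀ t → ∣E∣ (K t) ℕ.≤ t C 2
∣E∣-K zero    = z≤n
∣E∣-K (suc t) = begin
  ∣E∣ (K (suc t))                         ≤⟨ ⊆-length (edges-unique (K (suc t))) split ⟩
  length (at-zero ++ away)                ≡⟨ length-++ at-zero ⟩
  length at-zero + length away            ≡⟨ cong₂ _+_ (trans (length-map _ (allFin t)) (length-tabulate {n = t} id)) (length-map _ (edges (K t))) ⟩
  t + ∣E∣ (K t)                           ≤⟨ ℕ.+-monoʳ-≤ t (∣E∣-K t) ⟩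
  t + t C 2                               ≡⟨ [1+k]C2≡k+kC2 t ⟨
  suc t C 2                               ∎
  where
  open ℕ.≤-Reasoning
  at-zero away : List (Fin (suc t) × Fin (suc t))
  at-zero = map (λ v → zero , suc v) (allFin t)
  away    = map (λ (u , v) → suc u , suc v) (edges (K t))

  split : edges (K (suc t)) ⊆ at-zero ++ away
  split {u , v} e∈ with u | v | ∈-edges⁻ (K (suc t)) e∈
  ... | zero  | zero  | () , _
  ... | suc _ | zero  | () , _
  ... | zero  | suc v | _ = ∈-++⁺ˡ (∈-map⁺ _ (∈-allFin v))
  ... | suc u | suc v | s≤s u<v , u≢v =
    ∈-++⁺ʳ at-zero (∈-map⁺ _ (∈-edges⁺ (K t) u<v (u≢v ∘ cong suc)))

-- Edges inside a vertex set, and their growth with a new vertex.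

module _ {n : ℕ} (G : Graph n) where
  open Graph G
  open import Data.List.Membership.DecPropositional (Fin._≟_ {n}) using (_∈?_)

  within : List (Fin n) → List (Fin n × Fin n)
  within vs = filter (λ (u , v) → (u ∈? vs) ×-dec (v ∈? vs)) (edges G)

  ∈-within⁺ : ∀ {vs u v} → u ∈ vs → v ∈ vs → (u , v) ∈ edges G → (u , v) ∈ within vs
  ∈-within⁺ u∈vs v∈vs e∈ = ∈-filter⁺ _ e∈ (u∈vs , v∈vs)

  ∈-within⁻ : ∀ vs {u v} → (u , v) ∈ within vs → (u , v) ∈ edges G × u ∈ vs × v ∈ vs
  ∈-within⁻ vs = ∈-filter⁻ _ {xs = edges G}

  neighbours : Fin n → List (Fin n) → List (Fin n)
  neighbours v = filter (v ~?_)

  -- A new vertex may be smaller or larger than its neighbours, while `edges` lists each edge in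
  -- increasing order only.
  sort : Fin n → Fin n → Fin n × Fin n
  sort u v with u <? v
  ... | yes _ = u , v
  ... | no  _ = v , u

  sort-injective : ∀ u {v w} → sort u v ≡ sort u w → v ≡ w
  sort-injective u {v} {w} eq with u <? v | u <? w
  ... | yes _ | yes _ = ,-injectiveʳ eq
  -- Here `(u , v)` equals `(w , u)`, which forces both `v` and `w` to be `u`.
  ... | yes _ | no  _ = trans (,-injectiveʳ eq) (,-injectiveˡ eq)
  ... | no  _ | yes _ = trans (,-injectiveˡ eq) (,-injectiveʳ eq)
  ... | no  _ | no  _ = ,-injectiveˡ eq

  sort∈within : ∀ {vs u v} → u ∈ vs → v ∈ vs → u ~ v → sort u v ∈ within vs
  sort∈within {u = u} {v} u∈vs v∈vs u~v with u <? v
  ... | yes u<v = ∈-within⁺ u∈vs v∈vs (∈-edges⁺ G u<v u~v)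
  ... | no  u≮v = ∈-within⁺ v∈vs u∈vs (∈-edges⁺ G v<u (~-sym u~v))
    where
    v<u : v < u
    v<u = ℕ.≤∧≢⇒< (ℕ.≮⇒≥ u≮v) (λ v≡u → ~-irrefl (sym (Fin.toℕ-injective v≡u)) u~v)

  sort∉within : ∀ {vs u v} → u ∉ vs → sort u v ∉ within vs
  sort∉within {vs} {u} {v} u∉vs e∈ with u <? v
  ... | yes _ = u∉vs (proj₁ (proj₂ (∈-within⁻ vs e∈)))
  ... | no  _ = u∉vs (proj₂ (proj₂ (∈-within⁻ vs e∈)))

  -- The edges from `v` to its neighbours in `vs` are distinct because `sort v` is injective, and
  -- they are not old because an old edge has both ends in `vs`.
  length-within-∷ : ∀ {v vs} → v ∉ vs → Unique vs →
    length (within vs) + length (neighbours v vs) ℕ.≤ length (within (v ∷ vs))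
  length-within-∷ {v} {vs} v∉vs vs! = begin
    length (within vs) + length (neighbours v vs) ≡⟨ cong (length (within vs) ℕ.+_) (length-map (sort v) (neighbours v vs)) ⟨
    length (within vs) + length new               ≡⟨ length-++ (within vs) ⟨
    length (within vs ++ new)                     ≤⟨ ⊆-length unique included ⟩
    length (within (v ∷ vs))                      ∎
    where
    open ℕ.≤-Reasoning
    new : List (Fin n × Fin n)
    new = map (sort v) (neighbours v vs)

    unique : Unique (within vs ++ new)
    unique = Unique.++⁺ (Unique.filter⁺ _ (edges-unique G))
      (Unique.map⁺ (sort-injective v) (Unique.filter⁺ _ vs!))
      λ (e∈old , e∈new) → case ∈-map⁻ (sort v) e∈new of λ where
        (_ , _ , refl) → sort∉within v∉vs e∈old

    included : within vs ++ new ⊆ within (v ∷ vs)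
    included e∈ with ∈-++⁻ (within vs) e∈
    ... | inj₁ e∈old = let e∈E , u∈vs , w∈vs = ∈-within⁻ vs e∈old
                       in ∈-within⁺ (there u∈vs) (there w∈vs) e∈E
    ... | inj₂ e∈new with ∈-map⁻ (sort v) e∈new
    ...   | w , w∈N , refl = let w∈vs , v~w = ∈-filter⁻ (v ~?_) {xs = vs} w∈N
                             in sort∈within (here refl) (there w∈vs) v~w

  -- Coloured vertex sets and their extension by one vertex.

  ProperOn : ∀ {k} → List (Fin n) → (Fin n → Fin k) → Set
  ProperOn vs c = ∀ {u v} → u ∈ vs → v ∈ vs → u ~ v → c u ≢ c v

  properOn-∷ : ∀ {k v vs} {c : Fin n → Fin k} → ProperOn vs c →
    (∀ {w} → w ∈ vs → v ~ w → c w ≢ c v) → ProperOn (v ∷ vs) c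
  properOn-∷ p q (here refl) (here refl) v~v = contradiction v~v (~-irrefl refl)
  properOn-∷ p q (here refl) (there w∈)  v~w = q w∈ v~w ∘ sym
  properOn-∷ p q (there u∈)  (here refl) u~v = q u∈ (~-sym u~v)
  properOn-∷ p q (there u∈)  (there w∈)  u~w = p u∈ w∈ u~w

  -- `colour` is total, with arbitrary values outside `vs`, so that adding a vertex only overwrites
  -- one value. `k` counts the available colours.
  record Coloured (vs : List (Fin n)) : Set where
    field
      unique : Unique vs
      k      : ℕ
      colour : Fin n → Fin k
      proper : ProperOn vs colour
      bound  : k C 2 + length vs ℕ.≤ length (within vs) + k

  -- The growth starts from one vertex, as every further vertex must have an earlier neighbour.
  -- Since `1 C 2` is 0, the bound is `1 ≤ e + 1`.
  coloured-[_] : ∀ v → Coloured [ v ]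
  coloured-[ v ] = record
    { unique = [] ∷ []
    ; k      = 1
    ; colour = const zero
    ; proper = λ where (here refl) (here refl) v~v _ → ~-irrefl refl v~v
    ; bound  = ℕ.m≤n+m 1 (length (within [ v ]))
    }

  coloured-∷ : ∀ {u v vs} → Coloured vs → u ∈ vs → v ∉ vs → v ~ u → Coloured (v ∷ vs)
  coloured-∷ {u} {v} {vs} P u∈vs v∉vs v~u = case any? (λ j → ¬? (j ∈ᶜ? seen)) of λ where
      (yes (j , j∉seen)) → record
        { unique = v∷vs!
        ; k      = k
        ; colour = updateAt colour v (const j)
        ; proper = properOn-∷
            (λ x∈ y∈ x~y → subst₂ _≢_ (sym (unchanged x∈)) (sym (unchanged y∈)) (proper x∈ y∈ x~y))
            (λ w∈ v~w → subst₂ _≢_ (sym (unchanged w∈)) (sym (updateAt-updates v colour))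
              λ cw≡j → j∉seen (subst (_∈ seen) cw≡j (∈-map⁺ colour (∈-filter⁺ (v ~?_) w∈ v~w))))
        ; bound  = begin
            k C 2 + suc (length vs)                          ≡⟨ ℕ.+-suc (k C 2) (length vs) ⟩
            -- The earlier neighbour `u` gives `1 ≤ d`: the new edges pay for the new vertex.
            1 + (k C 2 + length vs)                          ≤⟨ ℕ.+-mono-≤ 1≤d bound ⟩
            d + (length (within vs) + k)                     ≡⟨ rearrange d (length (within vs)) k ⟩
            length (within vs) + d + k                       ≤⟨ ℕ.+-monoˡ-≤ k (length-within-∷ v∉vs unique) ⟩
            length (within (v ∷ vs)) + k                     ∎
        }
      (no ¬missing) → record
        { unique = v∷vs!
        ; k      = suc k
        -- Shifting the old colours by `suc` frees `zero` for `v`.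
        ; colour = updateAt (suc ∘ colour) v (const zero)
        ; proper = properOn-∷
            (λ x∈ y∈ x~y → subst₂ _≢_ (sym (unchanged x∈)) (sym (unchanged y∈))
              (proper x∈ y∈ x~y ∘ suc-injective))
            (λ w∈ _ → subst₂ _≢_ (sym (unchanged w∈)) (sym (updateAt-updates v (suc ∘ colour))) λ ())
        ; bound  = begin
            suc k C 2 + suc (length vs)                      ≡⟨ cong (_+ suc (length vs)) ([1+k]C2≡k+kC2 k) ⟩
            k + k C 2 + suc (length vs)                      ≡⟨ regroup k (k C 2) (length vs) ⟩
            -- The left side has grown by `k` for the colour and 1 for the vertex. The `d` new edges
            -- cover the former, and the extra colour on the right covers the latter.
            suc k + (k C 2 + length vs)                      ≤⟨ ℕ.+-mono-≤ (s≤s (k≤d ¬missing)) bound ⟩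
            suc d + (length (within vs) + k)                 ≡⟨ regroup′ d (length (within vs)) k ⟩
            length (within vs) + d + suc k                   ≤⟨ ℕ.+-monoˡ-≤ (suc k) (length-within-∷ v∉vs unique) ⟩
            length (within (v ∷ vs)) + suc k                 ∎
        }
    where
    open ℕ.≤-Reasoning
    open Coloured P
    open import Data.List.Membership.DecPropositional (Fin._≟_ {k}) using () renaming (_∈?_ to _∈ᶜ?_)

    d : ℕ
    d = length (neighbours v vs)

    seen : List (Fin k)
    seen = map colour (neighbours v vs)

    v∷vs! : Unique (v ∷ vs)
    v∷vs! = ¬Any⇒All¬ vs v∉vs ∷ unique

    unchanged : ∀ {m} {c : Fin n → Fin m} {j w} → w ∈ vs → updateAt c v (const j) w ≡ c w
    unchanged {c = c} {w = w} w∈ = updateAt-minimal w v c λ w≡v → v∉vs (subst (_∈ vs) w≡v w∈)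

    1≤d : 1 ℕ.≤ d
    1≤d = ∈-length (∈-filter⁺ (v ~?_) u∈vs v~u)

    -- Each neighbour shows one colour, so showing all `k` colours takes at least `k` neighbours.
    k≤d : ¬ (∃[ j ] j ∉ seen) → k ℕ.≤ d
    k≤d ¬missing = begin
      k                  ≡⟨ length-tabulate id ⟨
      length (allFin k)  ≤⟨ ⊆-length (Unique.allFin⁺ k) (λ {j} _ → decidable-stable (j ∈ᶜ? seen) (¬missing ∘ (j ,_))) ⟩
      length seen        ≡⟨ length-map colour (neighbours v vs) ⟩
      d                  ∎

    rearrange : ∀ a b c → a + (b + c) ≡ b + a + c
    rearrange = solve-∀

    regroup : ∀ a b c → a + b + suc c ≡ suc a + (b + c)
    regroup = solve-∀

    regroup′ : ∀ a b c → suc a + (b + c) ≡ b + a + suc c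
    regroup′ = solve-∀

  -- Exhausting a connected graph along paths.

  extend-along : ∀ {x y vs} → Star _~_ x y → Coloured vs → x ∈ vs → ∃[ ws ] (vs ⊆ ws × Coloured ws × y ∈ ws)
  extend-along {vs = vs} ε P x∈ = vs , id , P , x∈
  extend-along {vs = vs} (_◅_ {j = z} x~z z⋯y) P x∈ with z ∈? vs
  ... | yes z∈ = extend-along z⋯y P z∈
  -- The preceding vertex `x` of the path is already in the list, so it is the earlier neighbour
  -- that `z` needs.
  ... | no  z∉ with extend-along z⋯y (coloured-∷ P x∈ z∉ (~-sym x~z)) (here refl)
  ...   | ws , z∷vs⊆ws , Q , y∈ws = ws , z∷vs⊆ws ∘ there , Q , y∈ws

  -- The targets in `ts` are reached one after another. The member `x` is carried along as the start
  -- of the next path, and `r` seeds the list.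
  cover : (∀ u v → Star _~_ u v) → Fin n → (ts : List (Fin n)) →
    ∃[ vs ] (ts ⊆ vs × Coloured vs × ∃[ x ] x ∈ vs)
  cover conn r []       = [ r ] , (λ ()) , coloured-[ r ] , r , here refl
  cover conn r (t ∷ ts) with cover conn r ts
  ... | vs , ts⊆vs , P , x , x∈vs with extend-along (conn x t) P x∈vs
  ...   | ws , vs⊆ws , Q , t∈ws = ws , t∷ts⊆ws , Q , t , t∈ws
    where
    t∷ts⊆ws : t ∷ ts ⊆ ws
    t∷ts⊆ws (here refl) = t∈ws
    t∷ts⊆ws (there u∈)  = vs⊆ws (ts⊆vs u∈)

  colourable-within-excess : Connected G → ∃[ k ] (Colourable G k × k C 2 + n ℕ.≤ ∣E∣ G + k)
  colourable-within-excess (r , conn) with cover conn r (allFin n)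
  ... | vs , all⊆vs , P , _ = k , (colour , λ u v → proper (all⊆vs (∈-allFin u)) (all⊆vs (∈-allFin v))) , (begin
    k C 2 + n                    ≡⟨ cong (k C 2 ℕ.+_) (length-tabulate {n = n} id) ⟨
    k C 2 + length (allFin n)    ≤⟨ ℕ.+-monoʳ-≤ (k C 2) (⊆-length (Unique.allFin⁺ n) all⊆vs) ⟩
    k C 2 + length vs            ≤⟨ bound ⟩
    length (within vs) + k       ≤⟨ ℕ.+-monoˡ-≤ k (length-filter _ (edges G)) ⟩
    ∣E∣ G + k                    ∎)
    where
    open ℕ.≤-Reasoning
    open Coloured P

  -- From some proper colouring to the chromatic number.

  1≤χ : Fin n → 1 ℕ.≤ χ G
  1≤χ r with χ G | χ-isLeast G
  ... | zero  | (c , _) , _ = contradiction (c r) λ ()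
  ... | suc _ | _           = s≤s z≤n

  -- The colouring found may use more than `χ G` colours; monotonicity of `C(k,2) - k` lowers `k` to
  -- `χ G`, which is at least 1 because there is a vertex.
  χC2+∣V∣≤∣E∣+χ : Connected G → χ G C 2 + n ℕ.≤ ∣E∣ G + χ G
  χC2+∣V∣≤∣E∣+χ conn with colourable-within-excess conn
  -- Adding `k` to both sides lets the two subtraction-free inequalities be chained.
  ... | k , col , kC2+n≤∣E∣+k = ℕ.+-cancelʳ-≤ k _ _ (begin
    χ G C 2 + n + k      ≡⟨ swapʳ (χ G C 2) n k ⟩
    χ G C 2 + k + n      ≤⟨ ℕ.+-monoˡ-≤ n (C2-mono (1≤χ (proj₁ conn)) (ℕ.≤⇒≤′ (proj₂ (χ-isLeast G) k col))) ⟩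
    k C 2 + χ G + n      ≡⟨ swapʳ (k C 2) (χ G) n ⟩
    k C 2 + n + χ G      ≤⟨ ℕ.+-monoˡ-≤ (χ G) kC2+n≤∣E∣+k ⟩
    ∣E∣ G + k + χ G      ≡⟨ swapʳ (∣E∣ G) k (χ G) ⟩
    ∣E∣ G + χ G + k      ∎)
    where
    open ℕ.≤-Reasoning
    swapʳ : ∀ a b c → a + b + c ≡ a + c + b
    swapʳ = solve-∀

corollary2p2p1 : ∀ {n : ℕ} (G : Graph n) → Connected G →
    (ℶ¹ (K (χ G)) ≤ ℶ¹ G) ×
    (+ (χ G C 2) - + (χ G C 1) ≤ + ∣E∣ G - + ∣V∣ G)
corollary2p2p1 {n} G conn =
  m+q≤p+n⇒m-n≤p-q (∣E∣ (K (χ G))) (χ G) (∣E∣ G) n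
    (ℕ.≤-trans (ℕ.+-monoˡ-≤ n (∣E∣-K (χ G))) bound) ,
  m+q≤p+n⇒m-n≤p-q (χ G C 2) (χ G C 1) (∣E∣ G) n
    (subst (λ m → χ G C 2 + n ℕ.≤ ∣E∣ G + m) (sym (nC1≡n (χ G))) bound)
  where
  bound : χ G C 2 + n ℕ.≤ ∣E∣ G + χ G
  bound = χC2+∣V∣≤∣E∣+χ G conn
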